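{- Let $G$ be a connected twin-free graph with $\gamma^{\rm ID}(G)=4$. Then $\gamma^{\rm ID}(G \Box K_2) =\gamma^{\rm ID}(G)$ if and only if $G \in \mathcal{A}\bowtie K_1$, where the class $\mathcal{A}\bowtie K_1$ is defined in the context.
   Context: All graphs are finite, simple and undirected, considered up to isomorphism. $N[x]$ denotes the closed neighborhood of $x$; a graph is twin-free if no two distinct vertices have the same closed neighborhood. An identifying code (ID code) of a graph $F$ is a set $C\subseteq V(F)$ such that $N[x]\cap C\neq\emptyset$ for every vertex $x$ and $N[x]\cap C\neq N[y]\cap C$ for all distinct vertices $x,y$; $\gamma^{\rm ID}(F)$ is the minimum cardinality of an ID code of $F$. $\Box$ denotes the Cartesian product of graphs. The join $F_1\bowtie F_2$ is the disjoint union of $F_1$ and $F_2$ together with all edges between $V(F_1)$ and $V(F_2)$. For an integer $k\ge 1$, $A_k$ is the graph with vertex set $\{x_1,\dots,x_{2k}\}$ in which distinct $x_i,x_j$ are adjacent if and only if $|i-j|\le k-1$ (so $A_1=\overline{K_2}$ and $A_2=P_4$). $\mathcal{A}$ is the closure of $\{A_k : k\ge 1\}$ under $\bowtie$, i.e. the class of all graphs $A_{k_1}\bowtie\cdots\bowtie A_{k_r}$ with $r\ge 1$ and all $k_i\ge 1$. $\mathcal{A}\bowtie K_1=\{F\bowtie K_1 : F\in\mathcal{A}\}$. -}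

module Defs where

open import Data.Fin.Base using (Fin; toℕ; splitAt; remQuot)
open import Data.Fin.Properties using (_≟_)
open import Data.Fin.Subset using (Subset; Nonempty; _∩_; ∣_∣)
open import Data.Nat.Base using (ℕ; NonZero; _+_; _*_; _∸_; _≤_; ∣_-_∣)
open import Data.Nat.Properties using (_≤?_; ∣-∣-comm)
open import Data.Product.Base using (_×_; _,_; ∃-syntax)
open import Data.Sum.Base using (_⊎_; inj₁; inj₂)
open import Data.Unit.Base using (⊤; tt)
open import Data.Vec.Base using (tabulate)
open import Function.Base using (_on_)
open import Function.Bundles using (_↔_; _⇔_; Inverse)
open import Level using (0ℓ) renaming (suc to lsuc)
open import Relation.Binary.Construct.Closure.ReflexiveTransitive using (Star)
open import Relation.Binary.Core using (Rel)
open import Relation.Binary.Definitions using (Decidable; Irreflexive; Symmetric)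
open import Relation.Binary.PropositionalEquality
  using (_≡_; _≢_; refl; sym; subst; ≢-sym)
open import Relation.Nullary.Negation using (¬_)
open import Relation.Nullary.Decidable using (yes; does; ¬?; _×-dec_; _⊎-dec_)
open import Relation.Unary using (Pred)

record Graph : Set₁ where
  infix 4 _~_ _~?_
  field
    order    : ℕ
    _~_      : Rel (Fin order) 0ℓ
    _~?_     : Decidable _~_
    ~-sym    : Symmetric _~_
    ~-irrefl : Irreflexive _≡_ _~_

  N[_] : Fin order → Subset order
  N[ x ] = tabulate λ y → does ((y ≟ x) ⊎-dec (x ~? y))

open Graph using (order; N[_])

infix 4 _≅_

record _≅_ (G H : Graph) : Set where
  private
    module G = Graph G
    module H = Graph H
  field
    vertices  : Fin G.order ↔ Fin H.order
    adjacency : ∀ x y → (x G.~ y) ⇔ (Inverse.to vertices x H.~ Inverse.to vertices y)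

Connected : Graph → Set
Connected G = ∀ x y → Star (Graph._~_ G) x y

TwinFree : Graph → Set
TwinFree G = ∀ x y → x ≢ y → N[_] G x ≢ N[_] G y

record IsIDCode (G : Graph) (C : Subset (order G)) : Set where
  field
    dominating : ∀ x → Nonempty (N[_] G x ∩ C)
    separating : ∀ x y → x ≢ y → N[_] G x ∩ C ≢ N[_] G y ∩ C

-- A relation rather than a function, because a graph with twins has no
-- identifying code.  There is at most one m with IsγID G m.
record IsγID (G : Graph) (m : ℕ) : Set where
  field
    attained : ∃[ C ] IsIDCode G C × ∣ C ∣ ≡ m
    minimal  : ∀ C → IsIDCode G C → m ≤ ∣ C ∣

K : ℕ → Graph
K n = record
  { order    = n
  ; _~_      = _≢_
  ; _~?_     = λ x y → ¬? (x ≟ y)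
  ; ~-sym    = ≢-sym
  ; ~-irrefl = λ x≡y x≢y → x≢y x≡y
  }

infixr 7 _□_
infixr 6 _⋈_

-- Vertex i of G □ H is the pair remQuot i.
_□_ : Graph → Graph → Graph
G □ H = record
  { order    = G.order * H.order
  ; _~_      = _≈_ on remQuot H.order
  ; _~?_     = λ x y → dec (remQuot H.order x) (remQuot H.order y)
  ; ~-sym    = λ {x} {y} → symm (remQuot H.order x) (remQuot H.order y)
  ; ~-irrefl = λ { {x} refl → irrefl (remQuot H.order x) }
  }
  where
  module G = Graph G
  module H = Graph H

  _≈_ : Rel (Fin G.order × Fin H.order) 0ℓ
  (g , h) ≈ (g′ , h′) = (g ≡ g′ × h H.~ h′) ⊎ (g G.~ g′ × h ≡ h′)

  dec : Decidable _≈_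
  dec (g , h) (g′ , h′) =
    ((g ≟ g′) ×-dec (h H.~? h′)) ⊎-dec ((g G.~? g′) ×-dec (h ≟ h′))

  symm : ∀ p q → p ≈ q → q ≈ p
  symm _ _ (inj₁ (g≡ , h~)) = inj₁ (sym g≡ , H.~-sym h~)
  symm _ _ (inj₂ (g~ , h≡)) = inj₂ (G.~-sym g~ , sym h≡)

  irrefl : ∀ p → ¬ (p ≈ p)
  irrefl _ (inj₁ (_ , h~h)) = H.~-irrefl refl h~h
  irrefl _ (inj₂ (g~g , _)) = G.~-irrefl refl g~g

-- Vertex i of G ⋈ H is the vertex splitAt i of the disjoint union.
_⋈_ : Graph → Graph → Graph
G ⋈ H = record
  { order    = G.order + H.order
  ; _~_      = _≈_ on splitAt G.order
  ; _~?_     = λ x y → dec (splitAt G.order x) (splitAt G.order y)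
  ; ~-sym    = λ {x} {y} → symm (splitAt G.order x) (splitAt G.order y)
  ; ~-irrefl = λ { {x} refl → irrefl (splitAt G.order x) }
  }
  where
  module G = Graph G
  module H = Graph H

  _≈_ : Rel (Fin G.order ⊎ Fin H.order) 0ℓ
  inj₁ g ≈ inj₁ g′ = g G.~ g′
  inj₁ _ ≈ inj₂ _  = ⊤
  inj₂ _ ≈ inj₁ _  = ⊤
  inj₂ h ≈ inj₂ h′ = h H.~ h′

  dec : Decidable _≈_
  dec (inj₁ g) (inj₁ g′) = g G.~? g′
  dec (inj₁ _) (inj₂ _)  = yes tt
  dec (inj₂ _) (inj₁ _)  = yes tt
  dec (inj₂ h) (inj₂ h′) = h H.~? h′

  symm : ∀ p q → p ≈ q → q ≈ p
  symm (inj₁ _) (inj₁ _) = G.~-sym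
  symm (inj₁ _) (inj₂ _) = λ _ → tt
  symm (inj₂ _) (inj₁ _) = λ _ → tt
  symm (inj₂ _) (inj₂ _) = H.~-sym

  irrefl : ∀ p → ¬ (p ≈ p)
  irrefl (inj₁ _) = G.~-irrefl refl
  irrefl (inj₂ _) = H.~-irrefl refl

-- Vertices are numbered from 0 rather than 1, which leaves |i - j| unchanged.
A : ℕ → Graph
A k = record
  { order    = 2 * k
  ; _~_      = λ i j → i ≢ j × ∣ toℕ i - toℕ j ∣ ≤ k ∸ 1
  ; _~?_     = λ i j → ¬? (i ≟ j) ×-dec (∣ toℕ i - toℕ j ∣ ≤? k ∸ 1)
  ; ~-sym    = λ {i} {j} (i≢j , near) →
                 ≢-sym i≢j , subst (_≤ k ∸ 1) (∣-∣-comm (toℕ i) (toℕ j)) near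
  ; ~-irrefl = λ i≡j (i≢j , _) → i≢j i≡j
  }

data 𝒜 : Pred Graph (lsuc 0ℓ) where
  base : ∀ k → .{{NonZero k}} → 𝒜 (A k)
  join : ∀ {F H} → 𝒜 F → 𝒜 H → 𝒜 (F ⋈ H)

-- Graphs are taken up to isomorphism only here: _⋈_ respects _≅_, so closing
-- 𝒜 itself under _≅_ would not enlarge this class.
𝒜⋈K₁ : Pred Graph (lsuc 0ℓ)
𝒜⋈K₁ G = ∃[ F ] 𝒜 F × G ≅ F ⋈ K 1

{-# OPTIONS --safe #-}
-- Let C be a code of G □ K₂ with four elements.  A vertex x outside C in one
-- copy of G is identified in the other copy by N[x] ∩ C alone, so the number of
-- such x is less than 2 ^ j, where j is the number of code elements in the other
-- copy.  Of the possible distributions of C over the copies only 2 + 2 allows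
-- five vertices, and none allows more.  As 4 ≤ |G|, the graph G has order 4 or 5;
-- among those without isolated vertices and twins, only A₂ ⋈ K₁,
-- A₁ ⋈ A₁ ⋈ K₁ and the star K₁,₄ have no code of size 3, and the star fails for
-- K₁,₄ □ K₂.  This last step is an enumeration of adjacency matrices.
--
-- Conversely, in F ⋈ K₁ with F ∈ 𝒜 every vertex z of F separates some pair of
-- vertices that nothing else separates, so all of F lies in every code.  Hence
-- |F| ≤ 4 if γ is 4, which leaves A₂ and A₁ ⋈ A₁.
module Submission where

open import Defs
open import Data.Bool.Base using (Bool; true; false; T; _∧_)
open import Data.Bool.Properties using (T?; ∧-zeroʳ) renaming (_≟_ to _≟ᵇ_)
open import Data.Fin.Base as Fin
  using (Fin; zero; suc; toℕ; fromℕ<; combine; remQuot; splitAt; punchIn; _↑ˡ_; _↑ʳ_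
        ; funToFin; finToFun)
open import Data.Fin.Permutation using (Permutation′; insert; _⟨$⟩ʳ_) renaming (id to idₚ)
open import Data.Fin.Properties
  using (_≟_; all?; any?; injective⇒≤; suc-injective; toℕ-injective; toℕ<n; toℕ-fromℕ<; punchInᵢ≢i
        ; splitAt-↑ˡ; splitAt-↑ʳ; join-splitAt; ↑ˡ-injective; ↑ʳ-injective
        ; *↔×; remQuot-combine; combine-injectiveˡ; combine-surjective; finToFun-funToFin; 2↔Bool)
open import Data.Fin.Subset
  using (Subset; inside; outside; Nonempty; _∩_; ∣_∣; _∈_; _∉_; _⊆_; ⊥; ⊤; ∁)
open import Data.Fin.Subset.Properties
  using (∉⊥; ⊥⊆; ⊆-antisym; ⊆-reflexive; p∩q⊆q; x∈p∩q⁺; x∈p∩q⁻; x∈∁p⇒x∉p; ∣p∣≤n; ∣⊤∣≡n; ∣∁p∣≡n∸∣p∣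
        ; _∈?_; nonempty?; anySubset?)
open import Data.List.Base using (List; []; _∷_; concatMap) renaming (tabulate to tabulateₗ)
open import Data.List.Relation.Unary.Any as Any using (Any; here; there)
open import Data.Nat.Base using (ℕ; zero; suc; _+_; _*_; _∸_; _^_; _≤_; _<_; z≤n; s≤s; s≤s⁻¹; ∣_-_∣)
open import Data.Nat.Properties as ℕ using (≤-trans; ≤-antisym; _≤?_)
open import Data.Product.Base using (_×_; _,_; ∃-syntax; proj₁; proj₂)
open import Data.Product.Function.NonDependent.Propositional using (_×-↔_)
open import Data.Sum.Base using (_⊎_; inj₁; inj₂; [_,_]′)
import Data.Unit.Base as Unit
open import Data.Vec.Base using ([]; _∷_; here; there; lookup; tabulate)
open import Data.Vec.Properties
  using (≡-dec; lookup∘tabulate; tabulate∘lookup; tabulate-cong; lookup-zipWith; []=⇒lookup; lookup⇒[]=)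
open import Function.Base using (_∘_)
open import Function.Bundles using (_↔_; _⇔_; mk⇔; Inverse; Equivalence)
open import Function.Definitions using (Injective)
open import Function.Properties.Equivalence using () renaming (refl to ⇔-refl; sym to ⇔-sym; trans to ⇔-trans)
open import Function.Properties.Inverse using (↔-refl; ↔-sym; ↔-trans)
open import Relation.Binary.Construct.Closure.ReflexiveTransitive using (Star; ε; _◅_)
open import Relation.Binary.PropositionalEquality
open import Relation.Nullary.Decidable
  using (Dec; yes; no; does; ¬?; _×-dec_; _⊎-dec_; _→-dec_; map′; does-⇔; dec-true; dec-false
        ; toWitness; decidable-stable)
open import Relation.Nullary.Negation using (¬_; contradiction)
open import Relation.Unary using (Pred; Decidable)

open Graph using (order; N[_])

private variable
  m n : ℕ
  G H : Graph

-- Finite subsets: enumeration, preimages and counting.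

subset-ext : {p q : Subset n} → (∀ x → lookup p x ≡ lookup q x) → p ≡ q
subset-ext {p = p} {q} eq = trans (sym (tabulate∘lookup p)) (trans (tabulate-cong eq) (tabulate∘lookup q))

lookup-∩ : ∀ (p q : Subset n) x → lookup (p ∩ q) x ≡ lookup p x ∧ lookup q x
lookup-∩ p q x = lookup-zipWith _∧_ x p q

members : (p : Subset n) → Fin ∣ p ∣ → Fin n
members (outside ∷ p) i       = suc (members p i)
members (inside  ∷ p) zero    = zero
members (inside  ∷ p) (suc i) = suc (members p i)

members-∈ : ∀ (p : Subset n) i → members p i ∈ p
members-∈ (outside ∷ p) i       = there (members-∈ p i)
members-∈ (inside  ∷ p) zero    = here
members-∈ (inside  ∷ p) (suc i) = there (members-∈ p i)

members-injective : (p : Subset n) → Injective _≡_ _≡_ (members p)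
members-injective (outside ∷ p)                  eq = members-injective p (suc-injective eq)
members-injective (inside  ∷ p) {zero}  {zero}   eq = refl
members-injective (inside  ∷ p) {suc i} {suc j}  eq = cong suc (members-injective p (suc-injective eq))

members-surjective : ∀ (p : Subset n) {x} → x ∈ p → ∃[ i ] members p i ≡ x
members-surjective (inside  ∷ p) here      = zero , refl
members-surjective (inside  ∷ p) (there x∈p) =
  let i , eq = members-surjective p x∈p in suc i , cong suc eq
members-surjective (outside ∷ p) (there x∈p) =
  let i , eq = members-surjective p x∈p in i , cong suc eq

-- Enumerating both sets by `members` turns `f` into an injection between the index types, so the
-- pigeonhole principle applies.
∣∣-mono : ∀ (p : Subset m) (q : Subset n) {f : Fin m → Fin n} →
          Injective _≡_ _≡_ f → (∀ {x} → x ∈ p → f x ∈ q) → ∣ p ∣ ≤ ∣ q ∣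
∣∣-mono p q {f} f-inj f-mem = injective⇒≤ {f = proj₁ ∘ index} λ {i} {j} eq →
  members-injective p (f-inj
    (trans (sym (proj₂ (index i))) (trans (cong (members q) eq) (proj₂ (index j)))))
  where
  index : ∀ i → ∃[ j ] members q j ≡ f (members p i)
  index i = members-surjective q (f-mem (members-∈ p i))

preimage : (Fin m → Fin n) → Subset n → Subset m
preimage f p = tabulate (lookup p ∘ f)

∈-preimage⁺ : ∀ (f : Fin m → Fin n) p {x} → f x ∈ p → x ∈ preimage f p
∈-preimage⁺ f p {x} fx∈p =
  lookup⇒[]= x _ (trans (lookup∘tabulate (lookup p ∘ f) x) ([]=⇒lookup fx∈p))

∈-preimage⁻ : ∀ (f : Fin m → Fin n) p {x} → x ∈ preimage f p → f x ∈ p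
∈-preimage⁻ f p {x} x∈ =
  lookup⇒[]= (f x) p (trans (sym (lookup∘tabulate (lookup p ∘ f) x)) ([]=⇒lookup x∈))

preimage-∩ : ∀ (f : Fin m → Fin n) p q → preimage f (p ∩ q) ≡ preimage f p ∩ preimage f q
preimage-∩ f p q = subset-ext λ x → begin
  lookup (preimage f (p ∩ q)) x                        ≡⟨ lookup∘tabulate _ x ⟩
  lookup (p ∩ q) (f x)                                 ≡⟨ lookup-∩ p q (f x) ⟩
  lookup p (f x) ∧ lookup q (f x)                      ≡⟨ cong₂ _∧_ (lookup∘tabulate _ x) (lookup∘tabulate _ x) ⟨
  lookup (preimage f p) x ∧ lookup (preimage f q) x    ≡⟨ lookup-∩ (preimage f p) (preimage f q) x ⟨
  lookup (preimage f p ∩ preimage f q) x               ∎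
  where open ≡-Reasoning

to-injective : ∀ {A B : Set} (π : A ↔ B) → Injective _≡_ _≡_ (Inverse.to π)
to-injective π {x} {y} eq =
  trans (sym (strictlyInverseʳ x)) (trans (cong from eq) (strictlyInverseʳ y))
  where open Inverse π

from-injective : ∀ {A B : Set} (π : A ↔ B) → Injective _≡_ _≡_ (Inverse.from π)
from-injective π = to-injective (↔-sym π)

preimage-injective : ∀ (π : Fin m ↔ Fin n) {p q} →
                     preimage (Inverse.to π) p ≡ preimage (Inverse.to π) q → p ≡ q
preimage-injective π {p} {q} eq = subset-ext λ y → begin
  lookup p y                       ≡⟨ at-from p y ⟨
  lookup (preimage to p) (from y)  ≡⟨ cong (λ r → lookup r (from y)) eq ⟩
  lookup (preimage to q) (from y)  ≡⟨ at-from q y ⟩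
  lookup q y                       ∎
  where
  open ≡-Reasoning
  open Inverse π
  at-from : ∀ r y → lookup (preimage to r) (from y) ≡ lookup r y
  at-from r y = trans (lookup∘tabulate _ (from y)) (cong (lookup r) (strictlyInverseˡ y))

∣preimage∣ : ∀ (π : Fin m ↔ Fin n) p → ∣ preimage (Inverse.to π) p ∣ ≡ ∣ p ∣
∣preimage∣ π p = ≤-antisym
  (∣∣-mono _ p (to-injective π) (∈-preimage⁻ (Inverse.to π) p))
  (∣∣-mono p _ (from-injective π) λ {y} y∈p →
    ∈-preimage⁺ (Inverse.to π) p (subst (_∈ p) (sym (Inverse.strictlyInverseˡ π y)) y∈p))

-- The characteristic vector of `s` along the members of `D`, coded as one number. Points of `s`
-- outside `D` leave no mark, hence the inclusions assumed in `rank-injective`.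
rank : (D : Subset n) → Subset n → Fin (2 ^ ∣ D ∣)
rank D s = funToFin λ i → Inverse.from 2↔Bool (lookup s (members D i))

rank-injective : ∀ (D : Subset n) {s t} → s ⊆ D → t ⊆ D → rank D s ≡ rank D t → s ≡ t
rank-injective D {s} {t} s⊆D t⊆D eq = ⊆-antisym (included s⊆D eq) (included t⊆D (sym eq))
  where
  agree : ∀ {s t} → rank D s ≡ rank D t → ∀ i → lookup s (members D i) ≡ lookup t (members D i)
  agree {s} {t} eq i = from-injective 2↔Bool (begin
    bit s i                  ≡⟨ finToFun-funToFin (bit s) i ⟨
    finToFun (rank D s) i    ≡⟨ cong (λ c → finToFun c i) eq ⟩
    finToFun (rank D t) i    ≡⟨ finToFun-funToFin (bit t) i ⟩
    bit t i                  ∎)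
    where
    open ≡-Reasoning
    bit : Subset _ → Fin _ → Fin 2
    bit s i = Inverse.from 2↔Bool (lookup s (members D i))

  included : ∀ {s t} → s ⊆ D → rank D s ≡ rank D t → s ⊆ t
  included {s} {t} s⊆D eq {x} x∈s with i , refl ← members-surjective D (s⊆D x∈s) =
    lookup⇒[]= _ t (trans (sym (agree {s} {t} eq i)) ([]=⇒lookup x∈s))

-- The empty set joins the family as one more subset of `D`; this is where the strict inequality
-- comes from.
distinct-nonempty-subsets : ∀ (D : Subset n) {f : Fin m → Subset n} → Injective _≡_ _≡_ f →
                            (∀ i → Nonempty (f i)) → (∀ i → f i ⊆ D) → m < 2 ^ ∣ D ∣
distinct-nonempty-subsets {n} {m} D {f} f-inj f-ne f⊆D =
  injective⇒≤ {f = rank D ∘ f⁺} λ {i} {j} eq →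
    f⁺-inj i j (rank-injective D (f⁺⊆D i) (f⁺⊆D j) eq)
  where
  f⁺ : Fin (suc m) → Subset n
  f⁺ zero    = ⊥
  f⁺ (suc i) = f i

  f⁺⊆D : ∀ i → f⁺ i ⊆ D
  f⁺⊆D zero    = ⊥⊆
  f⁺⊆D (suc i) = f⊆D i

  f⁺-inj : ∀ i j → f⁺ i ≡ f⁺ j → i ≡ j
  f⁺-inj zero    zero    eq = refl
  f⁺-inj zero    (suc j) eq = contradiction (⊆-reflexive (sym eq) (proj₂ (f-ne j))) ∉⊥
  f⁺-inj (suc i) zero    eq = contradiction (⊆-reflexive eq (proj₂ (f-ne i))) ∉⊥
  f⁺-inj (suc i) (suc j) eq = cong suc (f-inj eq)

-- Closed neighborhoods, isomorphisms and invariance of identifying codes.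

T-does : ∀ {a} {A : Set a} (a? : Dec A) → A ⇔ T (does a?)
T-does (yes a) = mk⇔ (λ _ → _) (λ _ → a)
T-does (no ¬a) = mk⇔ ¬a (λ ())

ClosedAdj : (G : Graph) → Fin (order G) → Fin (order G) → Set
ClosedAdj G x y = y ≡ x ⊎ Graph._~_ G x y

closedAdj? : ∀ G x y → Dec (ClosedAdj G x y)
closedAdj? G x y = (y ≟ x) ⊎-dec Graph._~?_ G x y

lookup-N : ∀ G x y → lookup (N[_] G x) y ≡ does (closedAdj? G x y)
lookup-N G x y = lookup∘tabulate _ y

∈N⁺ : ∀ G {x y} → ClosedAdj G x y → y ∈ N[_] G x
∈N⁺ G {x} {y} adj = lookup⇒[]= y _ (trans (lookup-N G x y) (dec-true (closedAdj? G x y) adj))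

∈N⁻ : ∀ G {x y} → y ∈ N[_] G x → ClosedAdj G x y
∈N⁻ G {x} {y} y∈ = Equivalence.from (T-does (closedAdj? G x y))
  (subst T (sym (trans (sym (lookup-N G x y)) ([]=⇒lookup y∈))) _)

≅-refl : G ≅ G
≅-refl = record { vertices = ↔-refl ; adjacency = λ _ _ → ⇔-refl }

≅-sym : G ≅ H → H ≅ G
≅-sym {G} {H} G≅H = record
  { vertices  = ↔-sym vertices
  ; adjacency = λ x y → ⇔-sym (subst₂ (λ u v → (from x G.~ from y) ⇔ (u H.~ v))
      (strictlyInverseˡ x) (strictlyInverseˡ y) (adjacency (from x) (from y)))
  }
  where
  module G = Graph G
  module H = Graph H
  open _≅_ G≅H
  open Inverse vertices

≅-trans : ∀ {I} → G ≅ H → H ≅ I → G ≅ I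
≅-trans G≅H H≅I = record
  { vertices  = ↔-trans (_≅_.vertices G≅H) (_≅_.vertices H≅I)
  ; adjacency = λ x y → ⇔-trans (_≅_.adjacency G≅H x y) (_≅_.adjacency H≅I _ _)
  }

□-congʳ : ∀ I → G ≅ H → (G □ I) ≅ (H □ I)
□-congʳ {G} {H} I G≅H = record
  { vertices  = ↔-trans *↔× (↔-trans (vertices ×-↔ ↔-refl) (↔-sym *↔×))
  ; adjacency = λ x y →
      let a , i = remQuot {order G} (order I) x
          b , j = remQuot {order G} (order I) y
      -- Once `remQuot-combine` has turned the image vertices back into pairs, the two kinds of
      -- product edge transfer separately.
      in subst₂ (λ (u , k) (v , l) → Graph._~_ (G □ I) x y ⇔
                  (u ≡ v × Graph._~_ I k l ⊎ Graph._~_ H u v × k ≡ l))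
        (sym (remQuot-combine (to a) i)) (sym (remQuot-combine (to b) j))
        (mk⇔ (λ { (inj₁ (e , r)) → inj₁ (cong to e , r)
                ; (inj₂ (r , e)) → inj₂ (Equivalence.to (adjacency _ _) r , e) })
             (λ { (inj₁ (e , r)) → inj₁ (to-injective vertices e , r)
                ; (inj₂ (r , e)) → inj₂ (Equivalence.from (adjacency _ _) r , e) }))
  }
  where
  open _≅_ G≅H
  open Inverse vertices

module _ (G≅H : G ≅ H) where
  open _≅_ G≅H
  open Inverse vertices

  N-preimage : ∀ x → N[_] G x ≡ preimage to (N[_] H (to x))
  N-preimage x = subset-ext λ y → begin
    lookup (N[_] G x) y                          ≡⟨ lookup-N G x y ⟩
    does (closedAdj? G x y)                      ≡⟨ does-⇔ (equiv y) (closedAdj? G x y) (closedAdj? H _ _) ⟩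
    does (closedAdj? H (to x) (to y))            ≡⟨ lookup-N H (to x) (to y) ⟨
    lookup (N[_] H (to x)) (to y)                ≡⟨ lookup∘tabulate _ y ⟨
    lookup (preimage to (N[_] H (to x))) y       ∎
    where
    open ≡-Reasoning
    equiv : ∀ y → ClosedAdj G x y ⇔ ClosedAdj H (to x) (to y)
    equiv y = mk⇔
      [ inj₁ ∘ cong to , inj₂ ∘ Equivalence.to (adjacency x y) ]′
      [ inj₁ ∘ to-injective vertices , inj₂ ∘ Equivalence.from (adjacency x y) ]′

  -- Taking preimages commutes with `N[_]` and with `_∩_`, so every trace in `G` is the preimage of
  -- a trace in `H`; a bijection keeps nonempty sets nonempty and distinct sets distinct.
  isIDCode-preimage : ∀ {C} → IsIDCode H C → IsIDCode G (preimage to C)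
  isIDCode-preimage {C} code = record
    { dominating = λ x → let y , y∈ = dominating (to x) in
        from y , subst (from y ∈_) (sym (trace x))
          (∈-preimage⁺ to _ (subst (_∈ N[_] H (to x) ∩ C) (sym (strictlyInverseˡ y)) y∈))
    ; separating = λ x y x≢y eq → separating (to x) (to y) (x≢y ∘ to-injective vertices)
        (preimage-injective vertices (trans (sym (trace x)) (trans eq (trace y))))
    }
    where
    open IsIDCode code
    trace : ∀ x → N[_] G x ∩ preimage to C ≡ preimage to (N[_] H (to x) ∩ C)
    trace x = trans (cong (_∩ preimage to C) (N-preimage x)) (sym (preimage-∩ to (N[_] H (to x)) C))

isγID-resp-≅ : G ≅ H → IsγID G n → IsγID H n
isγID-resp-≅ G≅H γ = let C , code , size = attained in record
  { attained = _ , isIDCode-preimage (≅-sym G≅H) code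
             , trans (∣preimage∣ (_≅_.vertices (≅-sym G≅H)) C) size
  ; minimal  = λ C code → subst (_ ≤_) (∣preimage∣ (_≅_.vertices G≅H) C)
                 (minimal _ (isIDCode-preimage G≅H code))
  }
  where open IsγID γ

isγID-unique : IsγID G m → IsγID G n → m ≡ n
isγID-unique γ γ′ = ≤-antisym (below γ γ′) (below γ′ γ)
  where
  below : ∀ {m n} → IsγID G m → IsγID G n → m ≤ n
  below γ γ′ = let C , code , size = IsγID.attained γ′ in
    subst (_ ≤_) size (IsγID.minimal γ C code)

-- The traces of the vertices on the code are distinct nonempty subsets of it.
order<2^∣code∣ : ∀ {C} → IsIDCode G C → order G < 2 ^ ∣ C ∣
order<2^∣code∣ {G} {C} code = distinct-nonempty-subsets C {f = λ x → N[_] G x ∩ C}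
  (λ {x} {y} eq → decidable-stable (x ≟ y) λ x≢y → separating x y x≢y eq)
  dominating (λ x → p∩q⊆q (N[_] G x) C)
  where open IsIDCode code

-- Codes of `G □ K 2` and the bound on the order of `G`.

layer : ∀ n → Fin 2 → Subset (n * 2) → Subset n
layer n h C = preimage (λ g → combine g h) C

-- The two copies of a vertex occupy adjacent positions of the product, so the recursion consumes
-- two entries at a time, one for each layer.
∣layers∣ : ∀ n (C : Subset (n * 2)) → ∣ C ∣ ≡ ∣ layer n zero C ∣ + ∣ layer n (suc zero) C ∣
∣layers∣ zero [] = refl
∣layers∣ (suc n) (outside ∷ outside ∷ C) = ∣layers∣ n C
∣layers∣ (suc n) (outside ∷ inside  ∷ C) = trans (cong suc (∣layers∣ n C)) (sym (ℕ.+-suc _ _))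
∣layers∣ (suc n) (inside  ∷ outside ∷ C) = cong suc (∣layers∣ n C)
∣layers∣ (suc n) (inside  ∷ inside  ∷ C) = cong suc (trans (cong suc (∣layers∣ n C)) (sym (ℕ.+-suc _ _)))

module _ (G : Graph) {C : Subset (order G * 2)} (code : IsIDCode (G □ K 2) C) where
  open IsIDCode code

  private
    C[_] : Fin 2 → Subset (order G)
    C[ h ] = layer (order G) h C

    trace : Fin (order G) → Fin 2 → Subset (order G)
    trace x h = N[_] G x ∩ C[ h ]

    ∈-trace⁺ : ∀ {x y} h → y ∈ trace x h → combine y h ∈ N[_] (G □ K 2) (combine x h) ∩ C
    ∈-trace⁺ {x} {y} h y∈ with y∈N , y∈C ← x∈p∩q⁻ (N[_] G x) C[ h ] y∈ =
      x∈p∩q⁺ (∈N⁺ (G □ K 2) (closed (∈N⁻ G y∈N)) , ∈-preimage⁻ (λ g → combine g h) C y∈C)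
      where
      closed : ClosedAdj G x y → ClosedAdj (G □ K 2) (combine x h) (combine y h)
      closed (inj₁ refl) = inj₁ refl
      closed (inj₂ x~y)  = inj₂ (inj₂
        (subst₂ (λ (u , k) (v , l) → Graph._~_ G u v × k ≡ l)
          (sym (remQuot-combine x h)) (sym (remQuot-combine y h)) (x~y , refl)))

    -- The first alternative covers both the vertex itself and its copy in the other layer.
    closed-□⁻ : ∀ {x y h k} → ClosedAdj (G □ K 2) (combine x h) (combine y k) →
                y ≡ x ⊎ ClosedAdj G x y × k ≡ h
    closed-□⁻ {x} {y} {h} {k} (inj₁ eq) = inj₁ (combine-injectiveˡ y k x h eq)
    closed-□⁻ {x} {y} {h} {k} (inj₂ adj)
      with subst₂ (λ (u , k) (v , l) → u ≡ v × k ≢ l ⊎ Graph._~_ G u v × k ≡ l)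
                  (remQuot-combine x h) (remQuot-combine y k) adj
    ... | inj₁ (x≡y , _)   = inj₁ (sym x≡y)
    ... | inj₂ (x~y , h≡k) = inj₂ (inj₂ x~y , sym h≡k)

    -- A code vertex in the closed neighborhood of (x , h′) lies in layer `h′`, where it belongs to
    -- the trace, or is the copy (x , h), which `x ∉ C[ h ]` rules out.
    ∈-trace⁻ : ∀ {x z h h′} → h ≢ h′ → x ∉ C[ h ] → z ∈ N[_] (G □ K 2) (combine x h′) ∩ C →
               ∃[ y ] y ∈ trace x h′ × combine y h′ ≡ z
    ∈-trace⁻ {x} {z} {h} {h′} h≢h′ x∉ z∈
      with y , k , refl ← combine-surjective {order G} {2} z
      with z∈N , z∈C ← x∈p∩q⁻ (N[_] (G □ K 2) (combine x h′)) C z∈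
      with k ≟ h′ | closed-□⁻ {x} {y} {h′} {k} (∈N⁻ (G □ K 2) z∈N)
    ... | yes refl | inj₁ refl =
      y , x∈p∩q⁺ (∈N⁺ G (inj₁ refl) , ∈-preimage⁺ (λ g → combine g h′) C z∈C) , refl
    ... | yes refl | inj₂ (adj , _) =
      y , x∈p∩q⁺ (∈N⁺ G adj , ∈-preimage⁺ (λ g → combine g h′) C z∈C) , refl
    ... | no k≢h′  | inj₂ (_ , k≡h′) = contradiction k≡h′ k≢h′
    ... | no k≢h′  | inj₁ refl =
      contradiction (∈-preimage⁺ (λ g → combine g h) C
        (subst (λ l → combine x l ∈ C) (other h≢h′ k≢h′) z∈C)) x∉
      where
      other : {h h′ k : Fin 2} → h ≢ h′ → k ≢ h′ → k ≡ h
      other {zero}     {zero}     {_}        h≢h′ _ = contradiction refl h≢h′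
      other {suc zero} {suc zero} {_}        h≢h′ _ = contradiction refl h≢h′
      other {zero}     {suc zero} {zero}     _ _    = refl
      other {suc zero} {zero}     {suc zero} _ _    = refl
      other {zero}     {suc zero} {suc zero} _ k≢h′ = contradiction refl k≢h′
      other {suc zero} {zero}     {zero}     _ k≢h′ = contradiction refl k≢h′

  -- A vertex x outside layer h is identified within the layer h′ alone: the
  -- only neighbour of (x , h′) elsewhere is (x , h), which is not in the code.
  ∣∁layer∣<2^∣layer∣ : ∀ {h h′} → h ≢ h′ → order G ∸ ∣ C[ h ] ∣ < 2 ^ ∣ C[ h′ ] ∣
  ∣∁layer∣<2^∣layer∣ {h} {h′} h≢h′ = subst (_< 2 ^ ∣ C[ h′ ] ∣) (∣∁p∣≡n∸∣p∣ C[ h ])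
    (distinct-nonempty-subsets C[ h′ ] {f = λ i → trace (vertex i) h′}
      (λ {i} {j} eq → members-injective (∁ C[ h ]) (decidable-stable (vertex i ≟ vertex j) λ i≢j →
        separating (combine (vertex i) h′) (combine (vertex j) h′)
          (i≢j ∘ combine-injectiveˡ (vertex i) h′ (vertex j) h′)
          (⊆-antisym (included i j (⊆-reflexive eq)) (included j i (⊆-reflexive (sym eq))))))
      (λ i → let _ , z∈ = dominating (combine (vertex i) h′)
                 y , y∈ , _ = ∈-trace⁻ h≢h′ (outside-layer i) z∈
             in y , y∈)
      (λ i → p∩q⊆q (N[_] G (vertex i)) C[ h′ ]))
    where
    vertex : Fin ∣ ∁ C[ h ] ∣ → Fin (order G)
    vertex = members (∁ C[ h ])

    outside-layer : ∀ i → vertex i ∉ C[ h ]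
    outside-layer i = x∈∁p⇒x∉p (members-∈ (∁ C[ h ]) i)

    included : ∀ i j → trace (vertex i) h′ ⊆ trace (vertex j) h′ →
               N[_] (G □ K 2) (combine (vertex i) h′) ∩ C ⊆ N[_] (G □ K 2) (combine (vertex j) h′) ∩ C
    included i j sub z∈ with y , y∈ , refl ← ∈-trace⁻ h≢h′ (outside-layer i) z∈ = ∈-trace⁺ h′ (sub y∈)

  code□K₂-order : ∣ C ∣ ≡ 4 → order G ≤ 5
  code□K₂-order size = bound (order G) ∣ C[ zero ] ∣ ∣ C[ suc zero ] ∣
    (trans (sym (∣layers∣ (order G) C)) size)
    (∣∁layer∣<2^∣layer∣ {zero} {suc zero} λ ()) (∣∁layer∣<2^∣layer∣ {suc zero} {zero} λ ())
    where
    shift : ∀ {n a b} → n ∸ a < suc b → n ≤ a + b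
    shift {n} {a} lt = ≤-trans (ℕ.m≤n+m∸n n a) (ℕ.+-monoʳ-≤ a (s≤s⁻¹ lt))

    bound : ∀ n a b → a + b ≡ 4 → n ∸ a < 2 ^ b → n ∸ b < 2 ^ a → n ≤ 5
    -- In each case the larger layer is the one subtracted: the splits 4 + 0, 3 + 1 and 2 + 2 give
    -- at most 4 + 0, 3 + 1 and 2 + 3 vertices.
    bound n 0 _ refl _ lt = ℕ.m≤n⇒m≤1+n (shift {n} {4} lt)
    bound n 1 _ refl _ lt = ℕ.m≤n⇒m≤1+n (shift {n} {3} lt)
    bound n 2 _ refl lt _ = shift {n} {2} lt
    bound n 3 _ refl lt _ = ℕ.m≤n⇒m≤1+n (shift {n} {3} lt)
    bound n 4 _ refl lt _ = ℕ.m≤n⇒m≤1+n (shift {n} {4} lt)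

-- Decision procedures and the enumeration of graphs of order 4 and 5.

isIDCode? : ∀ G → Decidable (IsIDCode G)
isIDCode? G C = map′
  (λ (dominating , separating) → record { dominating = dominating ; separating = separating })
  (λ code → IsIDCode.dominating code , IsIDCode.separating code)
  (all? (λ x → nonempty? (N[_] G x ∩ C)) ×-dec
   all? (λ x → all? λ y → ¬? (x ≟ y) →-dec ¬? (≡-dec _≟ᵇ_ (N[_] G x ∩ C) (N[_] G y ∩ C))))

twinFree? : ∀ G → Dec (TwinFree G)
twinFree? G = all? λ x → all? λ y → ¬? (x ≟ y) →-dec ¬? (≡-dec _≟ᵇ_ (N[_] G x) (N[_] G y))

-- The obstruction to connectedness that the enumeration tests; unlike connectedness it can be read
-- off single rows of the matrix.
HasIsolated : Graph → Set
HasIsolated G = ∃[ x ] ∀ y → ¬ Graph._~_ G x y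

hasIsolated? : ∀ G → Dec (HasIsolated G)
hasIsolated? G = any? λ x → all? λ y → ¬? (Graph._~?_ G x y)

HasSmallCode : Graph → Set
HasSmallCode G = ∃[ C ] ∣ C ∣ < 4 × IsIDCode G C

hasSmallCode? : ∀ G → Dec (HasSmallCode G)
hasSmallCode? G = anySubset? λ C → (∣ C ∣ ℕ.<? 4) ×-dec isIDCode? G C

-- Existence alone is recorded, so that a finite search decides it and isomorphisms carry it over;
-- the matching lower bound is supplied by counting in `code□K₂⇒γ≡4`.
HasCode□K₂ : Graph → Set
HasCode□K₂ G = ∃[ C ] ∣ C ∣ ≡ 4 × IsIDCode (G □ K 2) C

hasCode□K₂? : ∀ G → Dec (HasCode□K₂ G)
hasCode□K₂? G = anySubset? λ C → (∣ C ∣ ℕ.≟ 4) ×-dec isIDCode? (G □ K 2) C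

-- The strict upper triangle of an adjacency matrix, row by row.
Matrix : ℕ → Set
Matrix zero    = Unit.⊤
Matrix (suc n) = Subset n × Matrix n

entry : Matrix n → Fin n → Fin n → Bool
entry {suc n} (r , M) zero    zero    = false
entry {suc n} (r , M) zero    (suc j) = lookup r j
entry {suc n} (r , M) (suc i) zero    = lookup r i
entry {suc n} (r , M) (suc i) (suc j) = entry M i j

entry-sym : ∀ (M : Matrix n) i j → T (entry M i j) → T (entry M j i)
entry-sym {suc n} (r , M) zero    (suc j) e = e
entry-sym {suc n} (r , M) (suc i) zero    e = e
entry-sym {suc n} (r , M) (suc i) (suc j) e = entry-sym M i j e

entry-irrefl : ∀ (M : Matrix n) i → ¬ T (entry M i i)
entry-irrefl {suc n} (r , M) (suc i) e = entry-irrefl M i e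

graph : Matrix n → Graph
graph {n} M = record
  { order    = n
  ; _~_      = λ i j → T (entry M i j)
  ; _~?_     = λ i j → T? (entry M i j)
  ; ~-sym    = λ {i} {j} → entry-sym M i j
  ; ~-irrefl = λ { {i} refl → entry-irrefl M i }
  }

matrix : (Fin n → Fin n → Bool) → Matrix n
matrix {zero}  f = _
matrix {suc n} f = tabulate (f zero ∘ suc) , matrix λ i j → f (suc i) (suc j)

-- `matrix` keeps only the values above the diagonal; `f-sym` recovers those below it and `f-irr`
-- the diagonal.
entry-matrix : ∀ (f : Fin n → Fin n → Bool) → (∀ i j → f i j ≡ f j i) → (∀ i → f i i ≡ false) →
               ∀ i j → entry (matrix f) i j ≡ f i j
entry-matrix f f-sym f-irr zero    zero    = sym (f-irr zero)
entry-matrix f f-sym f-irr zero    (suc j) = lookup∘tabulate _ j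
entry-matrix f f-sym f-irr (suc i) zero    = trans (lookup∘tabulate _ i) (f-sym zero (suc i))
entry-matrix f f-sym f-irr (suc i) (suc j) =
  entry-matrix (λ i j → f (suc i) (suc j)) (λ i j → f-sym (suc i) (suc j)) (f-irr ∘ suc) i j

adjacencyMatrix : ∀ G → Matrix (order G)
adjacencyMatrix G = matrix λ x y → does (x ~? y)
  where open Graph G

-- This replaces an arbitrary decidable adjacency relation by Boolean data, over which one can
-- enumerate.
≅-adjacencyMatrix : ∀ G → G ≅ graph (adjacencyMatrix G)
≅-adjacencyMatrix G = record
  { vertices  = _≅_.vertices (≅-refl {G})
  ; adjacency = λ x y → subst (λ b → (x ~ y) ⇔ T b) (sym (entries x y)) (T-does (x ~? y))
  }
  where
  open Graph G
  entries : ∀ x y → entry (adjacencyMatrix G) x y ≡ does (x ~? y)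
  entries = entry-matrix _ (λ x y → does-⇔ (mk⇔ ~-sym ~-sym) (x ~? y) (y ~? x))
                           (λ x → dec-false (x ~? x) (~-irrefl refl))

Relabels : Matrix n → Matrix n → Permutation′ n → Set
Relabels M L π = ∀ x y → entry M x y ≡ entry L (π ⟨$⟩ʳ x) (π ⟨$⟩ʳ y)

relabels? : ∀ (M L : Matrix n) → Decidable (Relabels M L)
relabels? M L π = all? λ x → all? λ y → entry M x y ≟ᵇ entry L (π ⟨$⟩ʳ x) (π ⟨$⟩ʳ y)

relabels⇒≅ : ∀ {M L : Matrix n} {πs} → Any (Relabels M L) πs → graph M ≅ graph L
relabels⇒≅ {M = M} {L} relabelled = let π , eq = Any.satisfied {P = Relabels M L} relabelled in record
  { vertices  = π
  ; adjacency = λ x y → mk⇔ (subst T (eq x y)) (subst T (sym (eq x y)))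
  }

-- A permutation of `suc n` points is the image `i` of `zero` together with a permutation of the
-- rest. The list supplies the isomorphisms found in `order5`.
permutations : ∀ n → List (Permutation′ n)
permutations zero    = idₚ ∷ []
permutations (suc n) = concatMap (λ π → tabulateₗ λ i → insert zero i π) (permutations n)

allSubsets? : ∀ {p} {P : Pred (Subset n) p} → Decidable P → Dec (∀ s → P s)
allSubsets? {zero}  P? = map′ (λ { p [] → p }) (λ f → f []) (P? [])
allSubsets? {suc n} P? = map′
  (λ { (f , g) (outside ∷ s) → f s ; (f , g) (inside ∷ s) → g s })
  (λ f → (λ s → f (outside ∷ s)) , (λ s → f (inside ∷ s)))
  (allSubsets? (P? ∘ (outside ∷_)) ×-dec allSubsets? (P? ∘ (inside ∷_)))

allMatrices? : ∀ {p} {P : Pred (Matrix n) p} → Decidable P → Dec (∀ M → P M)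
allMatrices? {zero}  P? = map′ (λ p _ → p) (λ f → f _) (P? _)
allMatrices? {suc n} P? = map′ (λ f (r , M) → f r M) (λ f r M → f (r , M))
  (allSubsets? λ r → allMatrices? λ M → P? (r , M))

star : Matrix 5
star = inside ∷ inside ∷ inside ∷ inside ∷ []
     , outside ∷ outside ∷ outside ∷ []
     , outside ∷ outside ∷ []
     , outside ∷ []
     , []
     , _

-- The gem, the wheel with four spokes and the star K₁,₄.
candidates : List (Matrix 5)
candidates = adjacencyMatrix (A 2 ⋈ K 1) ∷ adjacencyMatrix ((A 1 ⋈ A 1) ⋈ K 1) ∷ star ∷ []

-- Abstract, because unfolding the results would repeat the enumeration.
abstract
  order4 : ∀ (M : Matrix 4) → HasIsolated (graph M) ⊎ ¬ TwinFree (graph M) ⊎ HasSmallCode (graph M)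
  order4 = toWitness {a? = allMatrices? λ M →
    hasIsolated? (graph M) ⊎-dec ¬? (twinFree? (graph M)) ⊎-dec hasSmallCode? (graph M)} _

  order5 : ∀ (M : Matrix 5) → HasIsolated (graph M) ⊎ ¬ TwinFree (graph M) ⊎ HasSmallCode (graph M) ⊎
           Any (λ L → Any (Relabels M L) (permutations 5)) candidates
  order5 = toWitness {a? = allMatrices? λ M →
    hasIsolated? (graph M) ⊎-dec ¬? (twinFree? (graph M)) ⊎-dec hasSmallCode? (graph M) ⊎-dec
    Any.any? (λ L → Any.any? (relabels? M L) (permutations 5)) candidates} _

  ¬star-code : ¬ HasCode□K₂ (graph star)
  ¬star-code = toWitness {a? = ¬? (hasCode□K₂? (graph star))} _

  gem-code : HasCode□K₂ (A 2 ⋈ K 1)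
  gem-code = toWitness {a? = hasCode□K₂? (A 2 ⋈ K 1)} _

  wheel-code : HasCode□K₂ ((A 1 ⋈ A 1) ⋈ K 1)
  wheel-code = toWitness {a? = hasCode□K₂? ((A 1 ⋈ A 1) ⋈ K 1)} _

-- From a four-element code of `G □ K 2` to membership in `𝒜⋈K₁`.

isIDCode⇒twinFree : ∀ {G C} → IsIDCode G C → TwinFree G
isIDCode⇒twinFree {C = C} code x y x≢y eq = IsIDCode.separating code x y x≢y (cong (_∩ C) eq)

-- A walk from `x` to some other vertex must start with an edge at `x`.
connected⇒¬isolated : ∀ {G} → 2 ≤ order G → Connected G → ¬ HasIsolated G
connected⇒¬isolated {G} 2≤n conn (x , isolated) = let y , y≢x = another 2≤n x in stuck y≢x (conn x y)
  where
  another : ∀ {n} → 2 ≤ n → (x : Fin n) → ∃[ y ] y ≢ x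
  another (s≤s (s≤s _)) x = punchIn x zero , punchInᵢ≢i x zero

  stuck : ∀ {y} → y ≢ x → ¬ Star (Graph._~_ G) x y
  stuck y≢x ε         = y≢x refl
  stuck y≢x (adj ◅ _) = isolated _ adj

hasIsolated-resp-≅ : ∀ {G H} → G ≅ H → HasIsolated G → HasIsolated H
hasIsolated-resp-≅ {G} {H} G≅H (x , isolated) = to x , λ y adj →
  isolated (from y) (Equivalence.from (adjacency x (from y))
    (subst (Graph._~_ H (to x)) (sym (strictlyInverseˡ y)) adj))
  where
  open _≅_ G≅H
  open Inverse vertices

hasCode□K₂-resp-≅ : ∀ {G H} → G ≅ H → HasCode□K₂ G → HasCode□K₂ H
hasCode□K₂-resp-≅ {G} {H} G≅H (C , size , code) =
  _ , trans (∣preimage∣ (_≅_.vertices iso) C) size , isIDCode-preimage iso code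
  where
  iso : H □ K 2 ≅ G □ K 2
  iso = □-congʳ (K 2) (≅-sym G≅H)

γ≡4-graph∈𝒜⋈K₁ : ∀ {n} (M : Matrix n) → 4 ≤ n → n ≤ 5 → ¬ HasIsolated (graph M) →
                  IsγID (graph M) 4 → HasCode□K₂ (graph M) → 𝒜⋈K₁ (graph M)
γ≡4-graph∈𝒜⋈K₁ M 4≤n n≤5 ¬isolated γ code□ = by-order M 4≤n n≤5 ¬isolated twinFree ¬small code□
  where
  open IsγID γ

  twinFree : TwinFree (graph M)
  twinFree = isIDCode⇒twinFree (proj₁ (proj₂ attained))

  ¬small : ¬ HasSmallCode (graph M)
  ¬small (C , small , code) = ℕ.<⇒≱ small (minimal C code)

  fromCandidate : ∀ {M} → HasCode□K₂ (graph M) →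
                  Any (λ L → Any (Relabels M L) (permutations 5)) candidates → 𝒜⋈K₁ (graph M)
  fromCandidate _ (here relabelled) = A 2 , base 2 ,
    ≅-trans (relabels⇒≅ relabelled) (≅-sym (≅-adjacencyMatrix (A 2 ⋈ K 1)))
  fromCandidate _ (there (here relabelled)) = A 1 ⋈ A 1 , join (base 1) (base 1) ,
    ≅-trans (relabels⇒≅ relabelled) (≅-sym (≅-adjacencyMatrix ((A 1 ⋈ A 1) ⋈ K 1)))
  -- The assumed code would pass along the isomorphism to the product of the star with `K 2`.
  fromCandidate code□ (there (there (here relabelled))) =
    contradiction (hasCode□K₂-resp-≅ (relabels⇒≅ relabelled) code□) ¬star-code

  -- The facts proved above concern the fixed outer `M`; they become arguments here so that the
  -- order can be split by matching.
  by-order : ∀ {n} (M : Matrix n) → 4 ≤ n → n ≤ 5 → ¬ HasIsolated (graph M) →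
             TwinFree (graph M) → ¬ HasSmallCode (graph M) → HasCode□K₂ (graph M) → 𝒜⋈K₁ (graph M)
  by-order {4} M _ _ ¬isolated twinFree ¬small code□ =
    [ (λ isolated → contradiction isolated ¬isolated)
    , [ contradiction twinFree , (λ small → contradiction small ¬small) ]′ ]′ (order4 M)
  by-order {5} M _ _ ¬isolated twinFree ¬small code□ =
    [ (λ isolated → contradiction isolated ¬isolated)
    , [ contradiction twinFree
      , [ (λ small → contradiction small ¬small) , fromCandidate code□ ]′ ]′ ]′ (order5 M)
  by-order {3} _ (s≤s (s≤s (s≤s ()))) _
  by-order {2} _ (s≤s (s≤s ())) _
  by-order {1} _ (s≤s ()) _
  by-order {suc (suc (suc (suc (suc (suc _)))))} _ _ (s≤s (s≤s (s≤s (s≤s (s≤s ())))))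

γ□K₂≡γ⇒𝒜⋈K₁ : ∀ {G} → Connected G → IsγID G 4 → HasCode□K₂ G → 𝒜⋈K₁ G
γ□K₂≡γ⇒𝒜⋈K₁ {G} conn γ code□ =
  let F , F∈𝒜 , iso = γ≡4-graph∈𝒜⋈K₁ (adjacencyMatrix G) 4≤n n≤5
        (connected⇒¬isolated {G} (≤-trans (s≤s (s≤s z≤n)) 4≤n) conn ∘ hasIsolated-resp-≅ (≅-sym G≅M))
        (isγID-resp-≅ G≅M γ) (hasCode□K₂-resp-≅ G≅M code□)
  in F , F∈𝒜 , ≅-trans G≅M iso
  where
  G≅M : G ≅ graph (adjacencyMatrix G)
  G≅M = ≅-adjacencyMatrix G

  -- The four elements of a minimum code are vertices of `G`.
  4≤n : 4 ≤ order G
  4≤n = let C , _ , size = IsγID.attained γ in subst (_≤ order G) size (∣p∣≤n C)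

  n≤5 : order G ≤ 5
  n≤5 = let C , size , code = code□ in code□K₂-order G code size

-- Critical vertices and their behavior under joins.

-- In the second case N[x] misses z alone, so in F ⋈ K₁ only z separates x from
-- the new vertex.
Critical : (F : Graph) → Fin (order F) → Set
Critical F z =
  (∃[ x ] ∃[ y ] x ≢ y × ∀ w → w ≢ z → lookup (N[_] F x) w ≡ lookup (N[_] F y) w) ⊎
  (∃[ x ] ∀ w → w ≢ z → lookup (N[_] F x) w ≡ inside)

lookup-N-true : ∀ G {x y} → ClosedAdj G x y → lookup (N[_] G x) y ≡ inside
lookup-N-true G {x} {y} adj = trans (lookup-N G x y) (dec-true (closedAdj? G x y) adj)

lookup-N-⇔ : ∀ G H {x y u v} → ClosedAdj G x y ⇔ ClosedAdj H u v →
             lookup (N[_] G x) y ≡ lookup (N[_] H u) v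
lookup-N-⇔ G H {x} {y} {u} {v} equiv = trans (lookup-N G x y)
  (trans (does-⇔ equiv (closedAdj? G x y) (closedAdj? H u v)) (sym (lookup-N H u v)))

module _ (F H : Graph) where
  private
    a = order F
    b = order H

  N-⋈-ˡˡ : ∀ x y → lookup (N[_] (F ⋈ H) (x ↑ˡ b)) (y ↑ˡ b) ≡ lookup (N[_] F x) y
  N-⋈-ˡˡ x y = lookup-N-⇔ (F ⋈ H) F equiv
    where
    equiv : ClosedAdj (F ⋈ H) (x ↑ˡ b) (y ↑ˡ b) ⇔ ClosedAdj F x y
    -- Adjacency in a join computes only after `splitAt` has been evaluated at both vertices.
    equiv rewrite splitAt-↑ˡ a x b | splitAt-↑ˡ a y b =
      mk⇔ [ inj₁ ∘ ↑ˡ-injective b y x , inj₂ ]′ [ inj₁ ∘ cong (_↑ˡ b) , inj₂ ]′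

  N-⋈-ʳʳ : ∀ x y → lookup (N[_] (F ⋈ H) (a ↑ʳ x)) (a ↑ʳ y) ≡ lookup (N[_] H x) y
  N-⋈-ʳʳ x y = lookup-N-⇔ (F ⋈ H) H equiv
    where
    equiv : ClosedAdj (F ⋈ H) (a ↑ʳ x) (a ↑ʳ y) ⇔ ClosedAdj H x y
    equiv rewrite splitAt-↑ʳ a b x | splitAt-↑ʳ a b y =
      mk⇔ [ inj₁ ∘ ↑ʳ-injective a y x , inj₂ ]′ [ inj₁ ∘ cong (a ↑ʳ_) , inj₂ ]′

  N-⋈-ˡʳ : ∀ x y → lookup (N[_] (F ⋈ H) (x ↑ˡ b)) (a ↑ʳ y) ≡ inside
  N-⋈-ˡʳ x y = lookup-N-true (F ⋈ H) adj
    where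
    adj : ClosedAdj (F ⋈ H) (x ↑ˡ b) (a ↑ʳ y)
    adj rewrite splitAt-↑ˡ a x b | splitAt-↑ʳ a b y = inj₂ _

  N-⋈-ʳˡ : ∀ x y → lookup (N[_] (F ⋈ H) (a ↑ʳ x)) (y ↑ˡ b) ≡ inside
  N-⋈-ʳˡ x y = lookup-N-true (F ⋈ H) adj
    where
    adj : ClosedAdj (F ⋈ H) (a ↑ʳ x) (y ↑ˡ b)
    adj rewrite splitAt-↑ˡ a y b | splitAt-↑ʳ a b x = inj₂ _

  ⋈-elim : ∀ {p} {P : Fin (a + b) → Set p} → (∀ x → P (x ↑ˡ b)) → (∀ y → P (a ↑ʳ y)) → ∀ z → P z
  ⋈-elim {P = P} left right z = subst P (join-splitAt a b z) (helper (splitAt a z))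
    where
    helper : ∀ s → P (Fin.join a b s)
    helper (inj₁ x) = left x
    helper (inj₂ y) = right y

  -- Each vertex of `H` is adjacent to all of `F`, so it separates no two vertices of `F`.
  agree-ˡ : ∀ {x y z} → (∀ w → w ≢ z → lookup (N[_] F x) w ≡ lookup (N[_] F y) w) →
            ∀ w → w ≢ z ↑ˡ b → lookup (N[_] (F ⋈ H) (x ↑ˡ b)) w ≡ lookup (N[_] (F ⋈ H) (y ↑ˡ b)) w
  agree-ˡ {x} {y} agree = ⋈-elim
    (λ w w≢z → trans (N-⋈-ˡˡ x w) (trans (agree w (w≢z ∘ cong (_↑ˡ b))) (sym (N-⋈-ˡˡ y w))))
    (λ w _ → trans (N-⋈-ˡʳ x w) (sym (N-⋈-ˡʳ y w)))

  full-ˡ : ∀ {x z} → (∀ w → w ≢ z → lookup (N[_] F x) w ≡ inside) →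
           ∀ w → w ≢ z ↑ˡ b → lookup (N[_] (F ⋈ H) (x ↑ˡ b)) w ≡ inside
  full-ˡ {x} full = ⋈-elim
    (λ w w≢z → trans (N-⋈-ˡˡ x w) (full w (w≢z ∘ cong (_↑ˡ b))))
    (λ w _ → N-⋈-ˡʳ x w)

  critical-ˡ : ∀ {z} → Critical F z → Critical (F ⋈ H) (z ↑ˡ b)
  critical-ˡ (inj₁ (x , y , x≢y , agree)) =
    inj₁ (x ↑ˡ b , y ↑ˡ b , x≢y ∘ ↑ˡ-injective b x y , agree-ˡ agree)
  critical-ˡ (inj₂ (x , full)) = inj₂ (x ↑ˡ b , full-ˡ full)

  critical-ʳ : ∀ {z} → Critical H z → Critical (F ⋈ H) (a ↑ʳ z)
  critical-ʳ (inj₁ (x , y , x≢y , agree)) = inj₁ (a ↑ʳ x , a ↑ʳ y , x≢y ∘ ↑ʳ-injective a x y , ⋈-elim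
    (λ w _ → trans (N-⋈-ʳˡ x w) (sym (N-⋈-ʳˡ y w)))
    (λ w w≢z → trans (N-⋈-ʳʳ x w) (trans (agree w (w≢z ∘ cong (a ↑ʳ_))) (sym (N-⋈-ʳʳ y w)))))
  critical-ʳ (inj₂ (x , full)) = inj₂ (a ↑ʳ x , ⋈-elim
    (λ w _ → N-⋈-ʳˡ x w)
    (λ w w≢z → trans (N-⋈-ʳʳ x w) (full w (w≢z ∘ cong (a ↑ʳ_)))))

-- The one place where `p` and `q` may differ is erased by intersecting with `C`.
∩-agree : ∀ {n} {p q C : Subset n} {z} → z ∉ C →
          (∀ w → w ≢ z → lookup p w ≡ lookup q w) → p ∩ C ≡ q ∩ C
∩-agree {p = p} {q} {C} {z} z∉C agree = subset-ext λ w →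
  trans (lookup-∩ p C w) (trans (pointwise w) (sym (lookup-∩ q C w)))
  where
  pointwise : ∀ w → lookup p w ∧ lookup C w ≡ lookup q w ∧ lookup C w
  pointwise w with w ≟ z
  ... | no w≢z = cong (_∧ lookup C w) (agree w w≢z)
  ... | yes refl with lookup C w in eq
  ...   | true  = contradiction (lookup⇒[]= w C eq) z∉C
  ...   | false = trans (∧-zeroʳ _) (sym (∧-zeroʳ _))

-- If `z` were missing from the code, the two vertices that only `z` separates would have equal
-- traces. In the second case of `Critical` the partner of `x` is the vertex of `K 1`, whose closed
-- neighborhood is everything.
critical⇒∈code : ∀ {F C z} → IsIDCode (F ⋈ K 1) C → Critical F z → z ↑ˡ 1 ∈ C
critical⇒∈code {F} {C} {z} code crit = decidable-stable (z ↑ˡ 1 ∈? C) λ z∉C → separated z∉C crit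
  where
  open IsIDCode code

  universal : Fin (order F + 1)
  universal = order F ↑ʳ zero

  N-universal : ∀ w → lookup (N[_] (F ⋈ K 1) universal) w ≡ inside
  N-universal = ⋈-elim F (K 1) (N-⋈-ʳˡ F (K 1) zero)
    λ { zero → trans (N-⋈-ʳʳ F (K 1) zero zero) (lookup-N-true (K 1) {zero} (inj₁ refl)) }

  ≢universal : ∀ x → x ↑ˡ 1 ≢ universal
  ≢universal x eq
    with () ← trans (sym (splitAt-↑ˡ (order F) x 1))
                (trans (cong (splitAt (order F)) eq) (splitAt-↑ʳ (order F) 1 zero))

  separated : z ↑ˡ 1 ∉ C → ¬ Critical F z
  separated z∉C (inj₁ (x , y , x≢y , agree)) =
    separating (x ↑ˡ 1) (y ↑ˡ 1) (x≢y ∘ ↑ˡ-injective 1 x y) (∩-agree z∉C (agree-ˡ F (K 1) agree))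
  separated z∉C (inj₂ (x , full)) =
    separating (x ↑ˡ 1) universal (≢universal x)
      (∩-agree z∉C λ w w≢z → trans (full-ˡ F (K 1) full w w≢z) (sym (N-universal w)))

-- Every vertex of `A k` is critical.

near⇔ : ∀ m n j → (∣ m - n ∣ ≤ j) ⇔ (m ≤ n + j × n ≤ m + j)
near⇔ m n j = mk⇔
  (λ near → ≤-trans (ℕ.m≤n+∣m-n∣ m n) (ℕ.+-monoʳ-≤ n near)
          , ≤-trans (ℕ.m≤n+∣n-m∣ n m) (ℕ.+-monoʳ-≤ m near))
  λ (m≤ , n≤) → [ (λ eq → subst (_≤ j) (sym eq) (ℕ.m≤n+o⇒m∸n≤o m n m≤))
                , (λ eq → subst (_≤ j) (sym eq) (ℕ.m≤n+o⇒m∸n≤o n m n≤)) ]′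
                (ℕ.∣m-n∣≡[m∸n]∨[n∸m] m n)

module _ (j : ℕ) where
  private
    Near : Fin (2 * suc j) → Fin (2 * suc j) → Set
    Near x w = toℕ x ≤ toℕ w + j × toℕ w ≤ toℕ x + j

    -- The case `x ≡ w`, excluded from adjacency, returns in the closed neighborhood, which is
    -- therefore a full interval of radius `j`.
    closed⇔near : ∀ x w → ClosedAdj (A (suc j)) x w ⇔ Near x w
    closed⇔near x w = mk⇔
      [ (λ { refl → ℕ.m≤m+n _ j , ℕ.m≤m+n _ j })
      , (λ (_ , near) → Equivalence.to (near⇔ _ _ j) near) ]′
      λ near → closed (x ≟ w) (Equivalence.from (near⇔ _ _ j) near)
      where
      closed : Dec (x ≡ w) → ∣ toℕ x - toℕ w ∣ ≤ j → ClosedAdj (A (suc j)) x w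
      closed (yes x≡w) near = inj₁ (sym x≡w)
      closed (no  x≢w) near = inj₂ (x≢w , near)

    order≡ : 2 * suc j ≡ suc j + suc j
    order≡ = cong (suc j +_) (ℕ.+-identityʳ (suc j))

    toℕ≤ : ∀ w → toℕ w ≤ j + suc j
    toℕ≤ w = s≤s⁻¹ (subst (toℕ w <_) order≡ (toℕ<n w))

    vertex : ∀ i → i < suc j + suc j → ∃[ x ] toℕ {2 * suc j} x ≡ i
    vertex i i< = fromℕ< i<′ , toℕ-fromℕ< i<′
      where
      i<′ : i < 2 * suc j
      i<′ = subst (i <_) (sym order≡) i<

    upperVertex : ∀ i → i ≤ j → ∃[ x ] toℕ {2 * suc j} x ≡ i + suc j
    upperVertex i i≤j = vertex (i + suc j) (ℕ.+-monoˡ-< (suc j) (s≤s i≤j))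

    lowerVertex : ∀ i → i ≤ j → ∃[ x ] toℕ {2 * suc j} x ≡ i
    lowerVertex i i≤j = vertex i (≤-trans (s≤s i≤j) (ℕ.m≤m+n (suc j) (suc j)))

    -- The vertices fall into two halves, numbered 0 to j and j + 1 to 2j + 1; `i` is the position
    -- within a half.
    upper lower : ∀ i → i ≤ j → Fin (2 * suc j)
    upper i i≤j = proj₁ (upperVertex i i≤j)
    lower i i≤j = proj₁ (lowerVertex i i≤j)

    toℕ-upper : ∀ i i≤j → toℕ (upper i i≤j) ≡ i + suc j
    toℕ-upper i i≤j = proj₂ (upperVertex i i≤j)

    toℕ-lower : ∀ i i≤j → toℕ (lower i i≤j) ≡ i
    toℕ-lower i i≤j = proj₂ (lowerVertex i i≤j)

    distinct : ∀ {x y : Fin (2 * suc j)} {i} → toℕ x ≡ suc i → toℕ y ≡ i → x ≢ y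
    distinct x≡ y≡ refl = ℕ.1+n≢n (trans (sym x≡) y≡)

    -- The last vertex 2j + 1 is within distance `j`, so the interval is cut off only from below.
    N-upper : ∀ i i≤j w → ClosedAdj (A (suc j)) (upper i i≤j) w ⇔ (i < toℕ w)
    N-upper i i≤j w = ⇔-trans (closed⇔near _ w)
      (subst (λ x → (x ≤ toℕ w + j × toℕ w ≤ x + j) ⇔ (i < toℕ w)) (sym (toℕ-upper i i≤j)) (mk⇔
        (λ (le , _) → ℕ.+-cancelʳ-≤ j _ _ (subst (_≤ toℕ w + j) (ℕ.+-suc i j) le))
        (λ i<w → subst (_≤ toℕ w + j) (sym (ℕ.+-suc i j)) (ℕ.+-monoˡ-≤ j i<w)
               , ≤-trans (toℕ≤ w) (subst (_≤ i + suc j + j) (ℕ.+-comm (suc j) j)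
                   (ℕ.+-monoˡ-≤ j (ℕ.m≤n+m (suc j) i))))))

    -- Vertex 0 is within distance `j`, so the interval is cut off only from above.
    N-lower : ∀ i i≤j w → ClosedAdj (A (suc j)) (lower i i≤j) w ⇔ (toℕ w ≤ i + j)
    N-lower i i≤j w = ⇔-trans (closed⇔near _ w)
      (subst (λ x → (x ≤ toℕ w + j × toℕ w ≤ x + j) ⇔ (toℕ w ≤ i + j)) (sym (toℕ-lower i i≤j)) (mk⇔
        proj₂ (λ le → ≤-trans i≤j (ℕ.m≤n+m j (toℕ w)) , le)))

    -- The final segments around consecutive upper vertices differ in a single vertex, which runs
    -- through 1 to j. The remaining vertex 0 is the only one missed by the first upper vertex.
    critical-low : ∀ {z} i → toℕ z ≡ i → i ≤ j → Critical (A (suc j)) z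
    critical-low {z} zero eq 0≤j = inj₂ (upper 0 0≤j , λ w w≢z → lookup-N-true (A (suc j))
      (Equivalence.from (N-upper 0 0≤j w) (ℕ.n≢0⇒n>0 λ w≡0 → w≢z (toℕ-injective (trans w≡0 (sym eq))))))
    critical-low {z} (suc i) eq i<j = inj₁ (upper (suc i) i<j , upper i i≤j
      , distinct (toℕ-upper (suc i) i<j) (toℕ-upper i i≤j) , λ w w≢z →
      lookup-N-⇔ (A (suc j)) (A (suc j)) (⇔-trans (N-upper (suc i) i<j w) (⇔-trans
        (mk⇔ ℕ.<⇒≤ (λ i<w → ℕ.≤∧≢⇒< i<w λ eq′ → w≢z (toℕ-injective (trans (sym eq′) (sym eq)))))
        (⇔-sym (N-upper i i≤j w)))))
      where
      i≤j : i ≤ j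
      i≤j = ℕ.<⇒≤ i<j

    -- The mirror image of `critical-low`: initial segments around consecutive lower vertices differ
    -- in vertex i + j + 1, and for `i ≡ j` the last lower vertex misses only the vertex 2j + 1.
    critical-high : ∀ {z} i → toℕ z ≡ suc (i + j) → i ≤ j → Critical (A (suc j)) z
    critical-high {z} i eq i≤j with i ℕ.≟ j
    ... | yes refl = inj₂ (lower j i≤j , λ w w≢z → lookup-N-true (A (suc j))
      (Equivalence.from (N-lower j i≤j w) (s≤s⁻¹ (ℕ.≤∧≢⇒<
        (subst (toℕ w ≤_) (ℕ.+-suc j j) (toℕ≤ w)) λ eq′ → w≢z (toℕ-injective (trans eq′ (sym eq)))))))
    ... | no i≢j = inj₁ (lower i i≤j , lower (suc i) i<j
      , ≢-sym (distinct (toℕ-lower (suc i) i<j) (toℕ-lower i i≤j)) , λ w w≢z →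
      lookup-N-⇔ (A (suc j)) (A (suc j)) (⇔-trans (N-lower i i≤j w) (⇔-trans
        (mk⇔ ℕ.m≤n⇒m≤1+n (λ w≤ → s≤s⁻¹ (ℕ.≤∧≢⇒< w≤ λ eq′ → w≢z (toℕ-injective (trans eq′ (sym eq))))))
        (⇔-sym (N-lower (suc i) i<j w)))))
      where
      i<j : i < j
      i<j = ℕ.≤∧≢⇒< i≤j i≢j

  A-critical : ∀ z → Critical (A (suc j)) z
  A-critical z with toℕ z ≤? j
  ... | yes z≤j = critical-low (toℕ z) refl z≤j
  ... | no  z≰j = critical-high (toℕ z ∸ suc j)
    (sym (trans (sym (ℕ.+-suc _ j)) (ℕ.m∸n+n≡m (ℕ.≰⇒> z≰j))))
    (ℕ.m≤n+o⇒m∸n≤o (toℕ z) (suc j) (subst (toℕ z ≤_) (ℕ.+-comm j (suc j)) (toℕ≤ z)))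

-- Small members of `𝒜` and the converse implication.

𝒜-critical : ∀ {F} → 𝒜 F → ∀ z → Critical F z
𝒜-critical (base (suc j))              = A-critical j
𝒜-critical (join {F} {H} F∈𝒜 H∈𝒜) = ⋈-elim F H
  (critical-ˡ F H ∘ 𝒜-critical F∈𝒜) (critical-ʳ F H ∘ 𝒜-critical H∈𝒜)

𝒜-order≥2 : ∀ {F} → 𝒜 F → 2 ≤ order F
𝒜-order≥2 (base (suc j))     = ℕ.*-monoʳ-≤ 2 (s≤s (z≤n {j}))
𝒜-order≥2 (join F∈𝒜 H∈𝒜) = ≤-trans (𝒜-order≥2 F∈𝒜) (ℕ.m≤m+n _ _)

-- A join has at least 2 + 2 vertices. Since `𝒜` is generated literally by `A` and `_⋈_`, the
-- conclusion is an equality of graphs, fit for matching with `refl`.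
𝒜-order≤2 : ∀ {F} → 𝒜 F → order F ≤ 2 → F ≡ A 1
𝒜-order≤2 (base 1) _ = refl
𝒜-order≤2 (base (suc (suc j))) le =
  contradiction (ℕ.*-cancelˡ-≤ {suc (suc j)} {1} 2 le) λ { (s≤s ()) }
𝒜-order≤2 (join F∈𝒜 H∈𝒜) le =
  contradiction (≤-trans (ℕ.+-mono-≤ (𝒜-order≥2 F∈𝒜) (𝒜-order≥2 H∈𝒜)) le) λ { (s≤s (s≤s ())) }

-- Both sides of a join have at least two vertices, so a total of at most four leaves exactly two
-- for each.
𝒜-order-3-4 : ∀ {F} → 𝒜 F → 3 ≤ order F → order F ≤ 4 → F ≡ A 2 ⊎ F ≡ A 1 ⋈ A 1
𝒜-order-3-4 (base 1) (s≤s (s≤s ())) _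
𝒜-order-3-4 (base 2) _ _ = inj₁ refl
𝒜-order-3-4 (base (suc (suc (suc j)))) _ le =
  contradiction (ℕ.*-cancelˡ-≤ {suc (suc (suc j))} {2} 2 le) λ { (s≤s (s≤s ())) }
𝒜-order-3-4 (join {F} {H} F∈𝒜 H∈𝒜) _ le = inj₂ (cong₂ _⋈_
  (𝒜-order≤2 F∈𝒜 (ℕ.+-cancelʳ-≤ 2 _ _ (≤-trans (ℕ.+-monoʳ-≤ (order F) (𝒜-order≥2 H∈𝒜)) le)))
  (𝒜-order≤2 H∈𝒜 (ℕ.+-cancelˡ-≤ 2 _ _ (≤-trans (ℕ.+-monoˡ-≤ (order H) (𝒜-order≥2 F∈𝒜)) le))))

order≤∣code∣ : ∀ {F C} → 𝒜 F → IsIDCode (F ⋈ K 1) C → order F ≤ ∣ C ∣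
order≤∣code∣ {F} {C} F∈𝒜 code = subst (_≤ ∣ C ∣) (∣⊤∣≡n (order F))
  (∣∣-mono ⊤ C (↑ˡ-injective 1 _ _) λ {z} _ → critical⇒∈code code (𝒜-critical F∈𝒜 z))

-- Three code vertices have only 2 ^ 3 - 1 nonempty traces, for ten vertices.
code□K₂⇒γ≡4 : ∀ {G} → order G ≡ 5 → HasCode□K₂ G → IsγID (G □ K 2) 4
code□K₂⇒γ≡4 {G} order≡5 (C , size , code) = record
  { attained = C , code , size
  ; minimal  = λ D code′ → ℕ.≮⇒≥ λ ∣D∣<4 → ℕ.<⇒≱
      (ℕ.<-≤-trans (subst (λ n → n * 2 < 2 ^ ∣ D ∣) order≡5 (order<2^∣code∣ code′))
        (ℕ.^-monoʳ-≤ 2 (s≤s⁻¹ ∣D∣<4)))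
      (toWitness {a? = 8 ≤? 10} _)
  }

𝒜⋈K₁⇒γ□K₂≡γ : ∀ {G} → IsγID G 4 → 𝒜⋈K₁ G → IsγID (G □ K 2) 4
𝒜⋈K₁⇒γ□K₂≡γ {G} γ (F , F∈𝒜 , G≅) =
  isγID-resp-≅ (□-congʳ (K 2) (≅-sym G≅)) (γ□ (𝒜-order-3-4 F∈𝒜 3≤order order≤4))
  where
  open IsγID (isγID-resp-≅ G≅ γ)

  order≤4 : order F ≤ 4
  order≤4 = let C , code , size = attained in subst (order F ≤_) size (order≤∣code∣ F∈𝒜 code)

  -- A code of four elements needs four vertices, and `K 1` contributes one.
  3≤order : 3 ≤ order F
  3≤order = let C , _ , size = attained in
    ℕ.+-cancelʳ-≤ 1 3 _ (subst (_≤ order F + 1) size (∣p∣≤n C))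

  γ□ : F ≡ A 2 ⊎ F ≡ A 1 ⋈ A 1 → IsγID ((F ⋈ K 1) □ K 2) 4
  γ□ (inj₁ refl) = code□K₂⇒γ≡4 refl gem-code
  γ□ (inj₂ refl) = code□K₂⇒γ≡4 refl wheel-code

theorem13 : (G : Graph) → Connected G → TwinFree G → IsγID G 4 →
    (∃[ m ] IsγID (G □ K 2) m × IsγID G m) ⇔ 𝒜⋈K₁ G
theorem13 G conn _ γ = mk⇔
  -- Uniqueness of the identifying number forces `m` to be 4.
  (λ (m , γ□ , γ′) → let C , code , size = IsγID.attained γ□ in
    γ□K₂≡γ⇒𝒜⋈K₁ conn γ (C , trans size (isγID-unique γ′ γ) , code))
  (λ G∈ → 4 , 𝒜⋈K₁⇒γ□K₂≡γ γ G∈ , γ)
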